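{- For all integers $s > r \ge 2$, we have $\mathrm{ssat}(n, K_r, K_s) = n\binom{s-2}{r-1} - o(n)$ as $n \to \infty$.
   Context: A graph $G$ is strongly $F$-saturated if adding any edge (between two non-adjacent vertices) to $G$ creates a new copy of $F$; $G$ is not required to be $F$-free. $\mathrm{ssat}(n,H,F)$ denotes the minimum number of copies of $H$ in an $n$-vertex strongly $F$-saturated graph. $K_t$ denotes the complete graph on $t$ vertices. -}

module Defs where

open import Data.Nat using (ℕ; zero; suc; _+_; _*_; _≤_; _≡ᵇ_)
open import Data.Nat.Combinatorics using (_C_)
open import Data.Bool using (Bool; true; false; _∧_; _∨_; not; if_then_else_)
open import Data.Fin using (Fin; zero; suc)
open import Data.Fin.Properties using (_≟_)
open import Data.Fin.Subset using (Subset; _∈_; ∣_∣)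
open import Data.Vec using (Vec; []; _∷_; lookup)
open import Data.List using (List; []; _∷_; _++_; map; length; filterᵇ; allFin)
open import Data.Product using (Σ; _×_; _,_)
open import Relation.Nullary using (¬_; does)
open import Relation.Binary.PropositionalEquality using (_≡_; _≢_)

record Graph (n : ℕ) : Set where
  field
    adj   : Fin n → Fin n → Bool
    sym   : ∀ i j → adj i j ≡ adj j i
    irrefl : ∀ i → adj i i ≡ false
open Graph public

allB : {A : Set} → (A → Bool) → List A → Bool
allB p [] = true
allB p (x ∷ xs) = p x ∧ allB p xs

allSubsets : (n : ℕ) → List (Subset n)
allSubsets zero = [] ∷ []
allSubsets (suc n) = map (true ∷_) (allSubsets n) ++ map (false ∷_) (allSubsets n)

isClique : {n : ℕ} → (Fin n → Fin n → Bool) → Subset n → Bool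
isClique {n} a S =
  allB (λ i → allB (λ j →
        not (lookup S i ∧ lookup S j ∧ not (does (i ≟ j))) ∨ a i j)
      (allFin n)) (allFin n)

numK : {n : ℕ} → ℕ → Graph n → ℕ
numK {n} r G = length (filterᵇ (λ S → (∣ S ∣ ≡ᵇ r) ∧ isClique (adj G) S) (allSubsets n))

addEdge : {n : ℕ} → (Fin n → Fin n → Bool) → Fin n → Fin n → (Fin n → Fin n → Bool)
addEdge a u v i j =
  a i j ∨ ((does (i ≟ u) ∧ does (j ≟ v)) ∨ (does (i ≟ v) ∧ does (j ≟ u)))

-- G is strongly K_s-saturated: adding any non-edge uv creates a new copy
-- of K_s, i.e. an s-clique of G + uv containing both u and v.
StronglySat : {n : ℕ} → ℕ → Graph n → Set
StronglySat {n} s G =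
  (u v : Fin n) → u ≢ v → adj G u v ≡ false →
  Σ (Subset n) λ S → (∣ S ∣ ≡ s) × (u ∈ S) × (v ∈ S) × (isClique (addEdge (adj G) u v) S ≡ true)

IsSsat : ℕ → ℕ → ℕ → ℕ → Set
IsSsat n r s m =
  (Σ (Graph n) λ G → StronglySat s G × (numK r G ≡ m)) ×
  ((G : Graph n) → StronglySat s G → m ≤ numK r G)

{-# OPTIONS --safe #-}

-- Upper bound: join K_{s-2} to an independent set.
--
-- Lower bound: let c = C(s-2, r-1), and call a vertex heavy if it lies in at least D copies of
-- K_r, for a large constant D. If G has at most cn copies of K_r, only O(n / D) vertices are heavy.
-- A light vertex v is bad if fewer than c copies of K_r consist of v and heavy vertices; every
-- copy is counted for at most one light v, so G has at least c (n - #heavy - #bad) copies.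
-- If v is bad and u is a non-neighbour of v, the K_{s-2} in their common neighbourhood has a light
-- vertex w, and since r ≤ s-1 the pairs vw and wu each lie in a common K_r. Light vertices share
-- copies of K_r with boundedly many vertices, so v has boundedly many non-neighbours. If there were
-- many bad vertices, one could therefore choose greedily r pairwise adjacent bad vertices no
-- two of which lie in a common K_r, which is absurd. So the number of bad vertices is bounded.
module Submission where

open import Defs
open import Data.Nat using (ℕ; zero; suc; _+_; _*_; _∸_; _≤_; _<_; z≤n; s≤s; z<s; _≤?_; _≡ᵇ_; NonZero; >-nonZero)
import Data.Nat as ℕ
open import Data.Nat.Properties hiding (_≟_)
open import Data.Nat.Combinatorics using (_C_; nC1≡n; nCk+nC[k+1]≡[n+1]C[k+1])
open import Data.Nat.Induction using (<-rec)
open import Data.Nat.ListAction using (sum)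
open import Data.Nat.ListAction.Properties using (sum-++)
open import Data.Nat.Tactic.RingSolver using (solve-∀)
open import Algebra.Properties.CommutativeSemigroup +-commutativeSemigroup using (interchange)
open import Data.Bool using (Bool; true; false; _∧_; _∨_; not; if_then_else_)
import Data.Bool as Bool
open import Data.Bool.Properties using (T-≡; T-∧; T-∨; ∨-comm; ∨-zeroʳ; ∨-idem)
open import Data.Fin using (Fin; zero; suc; toℕ; combine; remQuot)
open import Data.Fin.Properties using (_≟_; all?; any?; remQuot-combine)
open import Data.Fin.Subset using (Subset; _∈_; _∉_; _⊆_; ∣_∣; _-_; _∪_; ⁅_⁆; ⊥)
open import Data.Fin.Subset.Properties
open import Data.Vec using ([]; _∷_; lookup; tabulate; here; there)
open import Data.Vec.Properties using ([]=⇒lookup; lookup⇒[]=; lookup∘tabulate)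
open import Data.List using (List; []; _∷_; _++_; map; length; filterᵇ; allFin)
open import Data.List.Properties using (map-++; map-∘; map-tabulate)
import Data.List.Membership.Propositional as List
open import Data.List.Membership.Propositional.Properties using (∈-allFin; ∈-++⁺ˡ; ∈-++⁺ʳ; ∈-map⁺)
open import Data.List.Relation.Unary.Any using (here; there)
open import Data.Product using (Σ; ∃; _×_; _,_; proj₁; proj₂)
open import Data.Sum using (_⊎_; inj₁; inj₂)
import Data.Sum as Sum
open import Function using (_∘_; id)
open import Function.Bundles using (Equivalence)
open import Relation.Nullary using (¬_; Dec; yes; no; does; contradiction)
open import Relation.Nullary.Decidable using (_×-dec_; _→-dec_; ¬?; map′; T?; decidable-stable; dec-true; dec-false)
open import Relation.Binary.PropositionalEquality using (_≡_; _≢_; refl; trans; cong; cong₂; subst; module ≡-Reasoning) renaming (sym to ≡-sym)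

private variable
  A B : Set
  P Q : Set
  n : ℕ

-- Finite sums over lists, vertices and vertex subsets

∑ : List A → (A → ℕ) → ℕ
∑ xs f = sum (map f xs)

∑-mono : ∀ (xs : List A) {f g : A → ℕ} → (∀ x → f x ≤ g x) → ∑ xs f ≤ ∑ xs g
∑-mono []       f≤g = z≤n
∑-mono (x ∷ xs) f≤g = +-mono-≤ (f≤g x) (∑-mono xs f≤g)

∑-cong : ∀ (xs : List A) {f g : A → ℕ} → (∀ x → f x ≡ g x) → ∑ xs f ≡ ∑ xs g
∑-cong []       f≡g = refl
∑-cong (x ∷ xs) f≡g = cong₂ _+_ (f≡g x) (∑-cong xs f≡g)

∑-zero : ∀ (xs : List A) → ∑ xs (λ _ → 0) ≡ 0
∑-zero []       = refl
∑-zero (x ∷ xs) = ∑-zero xs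

∑-+ : ∀ (xs : List A) (f g : A → ℕ) → ∑ xs (λ x → f x + g x) ≡ ∑ xs f + ∑ xs g
∑-+ []       f g = refl
∑-+ (x ∷ xs) f g = trans (cong (f x + g x +_) (∑-+ xs f g)) (interchange (f x) (g x) _ _)

∑-*ʳ : ∀ (xs : List A) (f : A → ℕ) c → ∑ xs (λ x → f x * c) ≡ ∑ xs f * c
∑-*ʳ []       f c = refl
∑-*ʳ (x ∷ xs) f c = trans (cong (f x * c +_) (∑-*ʳ xs f c)) (≡-sym (*-distribʳ-+ c (f x) _))

∑-*ˡ : ∀ (xs : List A) c (f : A → ℕ) → ∑ xs (λ x → c * f x) ≡ c * ∑ xs f
∑-*ˡ xs c f = trans (∑-cong xs (λ x → *-comm c (f x))) (trans (∑-*ʳ xs f c) (*-comm _ c))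

∑-swap : ∀ (xs : List A) (ys : List B) (f : A → B → ℕ) →
         ∑ xs (λ x → ∑ ys (f x)) ≡ ∑ ys (λ y → ∑ xs (λ x → f x y))
∑-swap []       ys f = ≡-sym (∑-zero ys)
∑-swap (x ∷ xs) ys f = trans (cong (∑ ys (f x) +_) (∑-swap xs ys f)) (≡-sym (∑-+ ys (f x) _))

∈⇒≤∑ : ∀ {xs : List A} (f : A → ℕ) {x} → x List.∈ xs → f x ≤ ∑ xs f
∈⇒≤∑ f (here refl) = m≤m+n _ _
∈⇒≤∑ f (there x∈)  = ≤-trans (∈⇒≤∑ f x∈) (m≤n+m _ _)

-- Averaging: if `g x ≤ f x` held at every entry, the sums would compare the other way. The greedy
-- choice finds its next vertex like this.
∑-<⇒∃< : ∀ (xs : List A) (f g : A → ℕ) → ∑ xs f < ∑ xs g → ∃ λ x → f x < g x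
∑-<⇒∃< (x ∷ xs) f g lt with suc (f x) ≤? g x
... | yes fx<gx = x , fx<gx
... | no  fx≮gx = ∑-<⇒∃< xs f g (≰⇒> λ le → <⇒≱ lt (+-mono-≤ (≮⇒≥ fx≮gx) le))

∑-++ : ∀ (xs ys : List A) (f : A → ℕ) → ∑ (xs ++ ys) f ≡ ∑ xs f + ∑ ys f
∑-++ xs ys f = trans (cong sum (map-++ f xs ys)) (sum-++ (map f xs) (map f ys))

∑-map : ∀ (h : A → B) (xs : List A) (f : B → ℕ) → ∑ (map h xs) f ≡ ∑ xs (f ∘ h)
∑-map h xs f = cong sum (≡-sym (map-∘ xs))

∑ᶠ : (Fin n → ℕ) → ℕ
∑ᶠ {n} = ∑ (allFin n)

∑ˢ : (Subset n → ℕ) → ℕ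
∑ˢ {n} = ∑ (allSubsets n)

∑ᶠ-suc : (f : Fin (suc n) → ℕ) → ∑ᶠ f ≡ f zero + ∑ᶠ (f ∘ suc)
∑ᶠ-suc f = cong ((f zero +_) ∘ sum) (trans (map-tabulate suc f) (≡-sym (map-tabulate id (f ∘ suc))))

∑ᶠ-const : ∀ n c → ∑ᶠ {n} (λ _ → c) ≡ n * c
∑ᶠ-const zero    c = refl
∑ᶠ-const (suc n) c = trans (∑ᶠ-suc {n} (λ _ → c)) (cong (c +_) (∑ᶠ-const n c))

∑ˢ-suc : (f : Subset (suc n) → ℕ) → ∑ˢ f ≡ ∑ˢ (f ∘ (true ∷_)) + ∑ˢ (f ∘ (false ∷_))
∑ˢ-suc {n} f = trans (∑-++ (map (true ∷_) (allSubsets n)) _ f)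
                     (cong₂ _+_ (∑-map (true ∷_) (allSubsets n) f) (∑-map (false ∷_) (allSubsets n) f))

∈-allSubsets : (S : Subset n) → S List.∈ allSubsets n
∈-allSubsets []          = here refl
∈-allSubsets (true  ∷ S) = ∈-++⁺ˡ (∈-map⁺ (true ∷_) (∈-allSubsets S))
∈-allSubsets (false ∷ S) = ∈-++⁺ʳ _ (∈-map⁺ (false ∷_) (∈-allSubsets S))

-- Indicators of decidable propositions

𝟙 : Dec P → ℕ
𝟙 P? = if does P? then 1 else 0

𝟙-yes : (P? : Dec P) → P → 𝟙 P? ≡ 1
𝟙-yes (yes _) p = refl
𝟙-yes (no ¬p) p = contradiction p ¬p

𝟙-no : (P? : Dec P) → ¬ P → 𝟙 P? ≡ 0
𝟙-no (yes p) ¬p = contradiction p ¬p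
𝟙-no (no _)  ¬p = refl

𝟙-≤ : (P? : Dec P) {m : ℕ} → (P → 1 ≤ m) → 𝟙 P? ≤ m
𝟙-≤ (yes p) h = h p
𝟙-≤ (no _)  h = z≤n

𝟙-mono : (P? : Dec P) (Q? : Dec Q) → (P → Q) → 𝟙 P? ≤ 𝟙 Q?
𝟙-mono P? Q? P⇒Q = 𝟙-≤ P? (λ p → ≤-reflexive (≡-sym (𝟙-yes Q? (P⇒Q p))))

𝟙-× : (P? : Dec P) (Q? : Dec Q) → 𝟙 (P? ×-dec Q?) ≡ 𝟙 P? * 𝟙 Q?
𝟙-× (yes _) (yes _) = refl
𝟙-× (yes _) (no _)  = refl
𝟙-× (no _)  _       = refl

𝟙*-cong : (P? : Dec P) {a b : ℕ} → (P → a ≡ b) → 𝟙 P? * a ≡ 𝟙 P? * b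
𝟙*-cong (yes p) h = cong (1 *_) (h p)
𝟙*-cong (no _)  h = refl

𝟙*-mono : (P? : Dec P) {a b : ℕ} → (P → a ≤ b) → 𝟙 P? * a ≤ 𝟙 P? * b
𝟙*-mono (yes p) h = *-monoʳ-≤ 1 (h p)
𝟙*-mono (no _)  h = z≤n

𝟙*-≤ : (P? : Dec P) {a b : ℕ} → (P → a ≤ b) → 𝟙 P? * a ≤ b
𝟙*-≤ (yes p) h = ≤-trans (≤-reflexive (*-identityˡ _)) (h p)
𝟙*-≤ (no _)  h = z≤n

≤-𝟙* : (P? : Dec P) → P → ∀ a → a ≤ 𝟙 P? * a
≤-𝟙* P? p a = ≤-reflexive (trans (≡-sym (*-identityˡ a)) (cong (_* a) (≡-sym (𝟙-yes P? p))))

m<𝟙⇒m≡0 : (P? : Dec P) {m : ℕ} → m < 𝟙 P? → P × m ≡ 0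
m<𝟙⇒m≡0 (yes p) (s≤s z≤n) = p , refl
m<𝟙⇒m≡0 (no _)  ()

∑ᶠ-𝟙≟ : (v : Fin n) → ∑ᶠ (λ u → 𝟙 (u ≟ v)) ≡ 1
∑ᶠ-𝟙≟ {suc n} zero    = trans (∑ᶠ-suc {n} (λ u → 𝟙 (u ≟ zero))) (cong suc (∑-zero (allFin n)))
∑ᶠ-𝟙≟ {suc n} (suc v) = trans (∑ᶠ-suc {n} (λ u → 𝟙 (u ≟ suc v))) (∑ᶠ-𝟙≟ v)

∑ᶠ-unique : {P : Fin n → Set} (P? : ∀ v → Dec (P v)) → (∀ {u v} → P u → P v → u ≡ v) →
            ∑ᶠ (λ v → 𝟙 (P? v)) ≤ 1
∑ᶠ-unique {n} P? unique with any? P?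
... | yes (v , pv) = ≤-trans (∑-mono (allFin n) (λ u → 𝟙-mono (P? u) (u ≟ v) (λ pu → unique pu pv)))
                             (≤-reflexive (∑ᶠ-𝟙≟ v))
... | no ∄v        = ≤-trans (≤-reflexive (trans (∑-cong (allFin n) (λ u → 𝟙-no (P? u) (λ pu → ∄v (u , pu))))
                                                 (∑-zero (allFin n)))) z≤n

∣S∣≡∑ : (S : Subset n) → ∣ S ∣ ≡ ∑ᶠ (λ i → 𝟙 (i ∈? S))
∣S∣≡∑ []          = refl
∣S∣≡∑ {suc n} S′@(true  ∷ S) = trans (cong suc (∣S∣≡∑ S)) (≡-sym (∑ᶠ-suc {n} (λ i → 𝟙 (i ∈? S′))))
∣S∣≡∑ {suc n} S′@(false ∷ S) = trans (∣S∣≡∑ S) (≡-sym (∑ᶠ-suc {n} (λ i → 𝟙 (i ∈? S′))))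

length-filterᵇ : (p : A → Bool) (xs : List A) → length (filterᵇ p xs) ≡ ∑ xs (λ x → 𝟙 (T? (p x)))
length-filterᵇ p []       = refl
length-filterᵇ p (x ∷ xs) with p x
... | true  = cong suc (length-filterᵇ p xs)
... | false = length-filterᵇ p xs

-- Finite subsets

∣p∣≡1+∣p-x∣ : {p : Subset n} {x : Fin n} → x ∈ p → ∣ p ∣ ≡ suc ∣ p - x ∣
∣p∣≡1+∣p-x∣ {p = true  ∷ p} here        = cong (suc ∘ ∣_∣) (≡-sym (p─⊥≡p p))
∣p∣≡1+∣p-x∣ {p = true  ∷ p} (there x∈p) = cong suc (∣p∣≡1+∣p-x∣ x∈p)
∣p∣≡1+∣p-x∣ {p = false ∷ p} (there x∈p) = ∣p∣≡1+∣p-x∣ x∈p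

∣p∪⁅x⁆∣≡1+∣p∣ : (p : Subset n) {x : Fin n} → x ∉ p → ∣ p ∪ ⁅ x ⁆ ∣ ≡ suc ∣ p ∣
∣p∪⁅x⁆∣≡1+∣p∣ (true  ∷ p) {zero}  x∉p = contradiction here x∉p
∣p∪⁅x⁆∣≡1+∣p∣ (false ∷ p) {zero}  x∉p = cong (suc ∘ ∣_∣) (∪-identityʳ p)
∣p∪⁅x⁆∣≡1+∣p∣ (true  ∷ p) {suc x} x∉p = cong suc (∣p∪⁅x⁆∣≡1+∣p∣ p (x∉p ∘ there))
∣p∪⁅x⁆∣≡1+∣p∣ (false ∷ p) {suc x} x∉p = ∣p∪⁅x⁆∣≡1+∣p∣ p (x∉p ∘ there)

∣p∪q∣≤∣p∣+∣q∣ : (p q : Subset n) → ∣ p ∪ q ∣ ≤ ∣ p ∣ + ∣ q ∣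
∣p∪q∣≤∣p∣+∣q∣ []          []          = z≤n
∣p∪q∣≤∣p∣+∣q∣ (true  ∷ p) (true  ∷ q) = s≤s (≤-trans (∣p∪q∣≤∣p∣+∣q∣ p q) (+-monoʳ-≤ ∣ p ∣ (n≤1+n _)))
∣p∪q∣≤∣p∣+∣q∣ (true  ∷ p) (false ∷ q) = s≤s (∣p∪q∣≤∣p∣+∣q∣ p q)
∣p∪q∣≤∣p∣+∣q∣ (false ∷ p) (true  ∷ q) = ≤-trans (s≤s (∣p∪q∣≤∣p∣+∣q∣ p q)) (≤-reflexive (≡-sym (+-suc ∣ p ∣ _)))
∣p∪q∣≤∣p∣+∣q∣ (false ∷ p) (false ∷ q) = ∣p∪q∣≤∣p∣+∣q∣ p q

x∉p-x : (p : Subset n) (x : Fin n) → x ∉ p - x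
x∉p-x (true  ∷ p) zero    ()
x∉p-x (false ∷ p) zero    ()
x∉p-x (_ ∷ p)     (suc x) (there x∈) = x∉p-x p x x∈

x∈p-y⇒x≢y : {p : Subset n} {x y : Fin n} → x ∈ p - y → x ≢ y
x∈p-y⇒x≢y {p = p} {x} x∈ refl = x∉p-x p x x∈

1≤∣p∣⇒∃∈ : (p : Subset n) → 1 ≤ ∣ p ∣ → ∃ λ x → x ∈ p
1≤∣p∣⇒∃∈ (true  ∷ p) le = zero , here
1≤∣p∣⇒∃∈ (false ∷ p) le with 1≤∣p∣⇒∃∈ p le
... | x , x∈p = suc x , there x∈p

2≤∣p∣⇒∃∈₂ : (p : Subset n) → 2 ≤ ∣ p ∣ → ∃ λ x → ∃ λ y → x ∈ p × y ∈ p × x ≢ y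
2≤∣p∣⇒∃∈₂ (true  ∷ p) (s≤s le) with 1≤∣p∣⇒∃∈ p le
... | x , x∈p = zero , suc x , here , there x∈p , λ ()
2≤∣p∣⇒∃∈₂ (false ∷ p) le with 2≤∣p∣⇒∃∈₂ p le
... | x , y , x∈p , y∈p , x≢y = suc x , suc y , there x∈p , there y∈p , λ { refl → x≢y refl }

-- Positions are scanned in order: members of `X` are kept, and other members of `U` are skipped as
-- long as enough of `U` remains to reach size `r`. This is how a pair of vertices inside a clique
-- extends to a clique of prescribed size.
⊆-interpolate : (X U : Subset n) (r : ℕ) → X ⊆ U → ∣ X ∣ ≤ r → r ≤ ∣ U ∣ →
                ∃ λ S → X ⊆ S × S ⊆ U × ∣ S ∣ ≡ r
⊆-interpolate []          []          zero    X⊆U lo hi = [] , id , id , refl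
⊆-interpolate (true  ∷ X) (false ∷ U) r       X⊆U lo hi with () ← X⊆U here
⊆-interpolate (true  ∷ X) (true  ∷ U) (suc r) X⊆U (s≤s lo) (s≤s hi)
  with ⊆-interpolate X U r (drop-∷-⊆ X⊆U) lo hi
... | S , X⊆S , S⊆U , eq = true ∷ S , s⊆s X⊆S , s⊆s S⊆U , cong suc eq
⊆-interpolate (false ∷ X) (false ∷ U) r       X⊆U lo hi
  with ⊆-interpolate X U r (drop-∷-⊆ X⊆U) lo hi
... | S , X⊆S , S⊆U , eq = false ∷ S , s⊆s X⊆S , s⊆s S⊆U , eq
⊆-interpolate (false ∷ X) (true  ∷ U) r       X⊆U lo hi with r ≤? ∣ U ∣
-- Skipping the head would leave too few vertices, so `r` is `suc ∣ U ∣` and everything must be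
-- taken.
... | no  r≰∣U∣ = true ∷ U , X⊆U , id , ≤-antisym (≰⇒> r≰∣U∣) hi
... | yes hi′ with ⊆-interpolate X U r (drop-∷-⊆ X⊆U) lo hi′
... | S , X⊆S , S⊆U , eq = false ∷ S , s⊆s X⊆S , out⊆ S⊆U , eq

-- Counting subsets

_⊆[_]_ : Subset n → ℕ → Subset n → Set
S ⊆[ r ] U = ∣ S ∣ ≡ r × S ⊆ U

_⊆[_]?_ : (S : Subset n) (r : ℕ) (U : Subset n) → Dec (S ⊆[ r ] U)
S ⊆[ r ]? U = (∣ S ∣ ℕ.≟ r) ×-dec (S ⊆? U)

∑ˢ-suc-≥ : (f : Subset (suc n) → ℕ) {g h : Subset n → ℕ} →
           (∀ S → g S ≤ f (true ∷ S)) → (∀ S → h S ≤ f (false ∷ S)) → ∑ˢ g + ∑ˢ h ≤ ∑ˢ f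
∑ˢ-suc-≥ {n} f g≤f h≤f =
  ≤-trans (+-mono-≤ (∑-mono (allSubsets n) g≤f) (∑-mono (allSubsets n) h≤f)) (≤-reflexive (≡-sym (∑ˢ-suc f)))

∑ˢ-suc-≤ : (f : Subset (suc n) → ℕ) {g h : Subset n → ℕ} →
           (∀ S → f (true ∷ S) ≤ g S) → (∀ S → f (false ∷ S) ≤ h S) → ∑ˢ f ≤ ∑ˢ g + ∑ˢ h
∑ˢ-suc-≤ {n} f f≤g f≤h =
  ≤-trans (≤-reflexive (∑ˢ-suc f)) (+-mono-≤ (∑-mono (allSubsets n) f≤g) (∑-mono (allSubsets n) f≤h))

∑ˢ-outside : (f : Subset (suc n) → ℕ) {h : Subset n → ℕ} → (∀ S → h S ≤ f (false ∷ S)) → ∑ˢ h ≤ ∑ˢ f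
∑ˢ-outside {n} f h≤f = ≤-trans (m≤n+m _ _) (∑ˢ-suc-≥ f {λ _ → 0} (λ _ → z≤n) h≤f)

∑ˢ-inside : (f : Subset (suc n) → ℕ) {g : Subset n → ℕ} → (∀ S → g S ≤ f (true ∷ S)) → ∑ˢ g ≤ ∑ˢ f
∑ˢ-inside {n} f g≤f = ≤-trans (m≤m+n _ _) (∑ˢ-suc-≥ f {h = λ _ → 0} g≤f (λ _ → z≤n))

-- Pascal's rule: its two summands count the sets with and without the first position.
C≤#⊆ : (U : Subset n) (r : ℕ) → ∣ U ∣ C r ≤ ∑ˢ (λ S → 𝟙 (S ⊆[ r ]? U))
C≤#⊆ []          zero    = ≤-refl
C≤#⊆ []          (suc r) = ≤-refl
C≤#⊆ (false ∷ U) r = ≤-trans (C≤#⊆ U r) (∑ˢ-outside _ λ S →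
  𝟙-mono (S ⊆[ r ]? U) ((false ∷ S) ⊆[ r ]? (false ∷ U)) λ h → proj₁ h , s⊆s (proj₂ h))
C≤#⊆ (true ∷ U) zero = ≤-trans (C≤#⊆ U 0) (∑ˢ-outside _ λ S →
  𝟙-mono (S ⊆[ 0 ]? U) ((false ∷ S) ⊆[ 0 ]? (true ∷ U)) λ h → proj₁ h , out⊆ (proj₂ h))
C≤#⊆ (true ∷ U) (suc r) = begin
  suc ∣ U ∣ C suc r          ≡⟨ nCk+nC[k+1]≡[n+1]C[k+1] ∣ U ∣ r ⟨
  ∣ U ∣ C r + ∣ U ∣ C suc r  ≤⟨ +-mono-≤ (C≤#⊆ U r) (C≤#⊆ U (suc r)) ⟩
  _                          ≤⟨ ∑ˢ-suc-≥ _
    (λ S → 𝟙-mono (S ⊆[ r ]? U) ((true ∷ S) ⊆[ suc r ]? (true ∷ U)) λ h → cong suc (proj₁ h) , s⊆s (proj₂ h))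
    (λ S → 𝟙-mono (S ⊆[ suc r ]? U) ((false ∷ S) ⊆[ suc r ]? (true ∷ U)) λ h → proj₁ h , out⊆ (proj₂ h)) ⟩
  _                          ∎
  where open ≤-Reasoning

-- A set counted here is `v` together with `r` of the other `q` members of `U`. Pascal's rule peels
-- off the positions before `v`; once `v` is reached, `C≤#⊆` counts the choices that are left.
C≤#⊆∋ : (U : Subset n) {v : Fin n} (q r : ℕ) → v ∈ U → ∣ U ∣ ≡ suc q →
        q C r ≤ ∑ˢ (λ S → 𝟙 ((v ∈? S) ×-dec (S ⊆[ suc r ]? U)))
C≤#⊆∋ (true ∷ U) q r here refl = ≤-trans (C≤#⊆ U r) (∑ˢ-inside _ λ S →
  𝟙-mono (S ⊆[ r ]? U) ((zero ∈? (true ∷ S)) ×-dec ((true ∷ S) ⊆[ suc r ]? (true ∷ U)))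
    λ h → here , cong suc (proj₁ h) , s⊆s (proj₂ h))
C≤#⊆∋ (false ∷ U) {suc v} q r (there v∈U) eq = ≤-trans (C≤#⊆∋ U q r v∈U eq) (∑ˢ-outside _ λ S →
  𝟙-mono ((v ∈? S) ×-dec (S ⊆[ suc r ]? U)) ((suc v ∈? (false ∷ S)) ×-dec ((false ∷ S) ⊆[ suc r ]? (false ∷ U)))
    λ h → there (proj₁ h) , proj₁ (proj₂ h) , s⊆s (proj₂ (proj₂ h)))
-- The head and `v` are two members, so the size cannot be 1.
C≤#⊆∋ (true ∷ U) {suc v} zero r (there v∈U) eq with () ← trans (≡-sym (∣p∣≡1+∣p-x∣ v∈U)) (suc-injective eq)
C≤#⊆∋ (true ∷ U) {suc v} (suc q) zero (there v∈U) eq =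
  ≤-trans (C≤#⊆∋ U q zero v∈U (suc-injective eq)) (∑ˢ-outside _ λ S →
  𝟙-mono ((v ∈? S) ×-dec (S ⊆[ 1 ]? U)) ((suc v ∈? (false ∷ S)) ×-dec ((false ∷ S) ⊆[ 1 ]? (true ∷ U)))
    λ h → there (proj₁ h) , proj₁ (proj₂ h) , out⊆ (proj₂ (proj₂ h)))
C≤#⊆∋ (true ∷ U) {suc v} (suc q) (suc r) (there v∈U) eq = begin
  suc q C suc r      ≡⟨ nCk+nC[k+1]≡[n+1]C[k+1] q r ⟨
  q C r + q C suc r  ≤⟨ +-mono-≤ (C≤#⊆∋ U q r v∈U (suc-injective eq)) (C≤#⊆∋ U q (suc r) v∈U (suc-injective eq)) ⟩
  _                  ≤⟨ ∑ˢ-suc-≥ _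
    (λ S → 𝟙-mono ((v ∈? S) ×-dec (S ⊆[ suc r ]? U))
      ((suc v ∈? (true ∷ S)) ×-dec ((true ∷ S) ⊆[ suc (suc r) ]? (true ∷ U)))
      λ h → there (proj₁ h) , cong suc (proj₁ (proj₂ h)) , s⊆s (proj₂ (proj₂ h)))
    (λ S → 𝟙-mono ((v ∈? S) ×-dec (S ⊆[ suc (suc r) ]? U))
      ((suc v ∈? (false ∷ S)) ×-dec ((false ∷ S) ⊆[ suc (suc r) ]? (true ∷ U)))
      λ h → there (proj₁ h) , proj₁ (proj₂ h) , out⊆ (proj₂ (proj₂ h))) ⟩
  _                  ∎
  where open ≤-Reasoning

#size≤C : ∀ n r → ∑ˢ {n} (λ S → 𝟙 (∣ S ∣ ℕ.≟ r)) ≤ n C r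
#size≤C zero    zero    = ≤-refl
#size≤C zero    (suc r) = ≤-refl
#size≤C (suc n) zero    = ≤-trans
  (∑ˢ-suc-≤ {n} _ {λ _ → 0} {λ S → 𝟙 (∣ S ∣ ℕ.≟ 0)} (λ _ → z≤n) (λ _ → ≤-refl))
  (+-mono-≤ (≤-reflexive (∑-zero (allSubsets n))) (#size≤C n zero))
#size≤C (suc n) (suc r) = begin
  _                  ≤⟨ ∑ˢ-suc-≤ {n} _ {λ S → 𝟙 (∣ S ∣ ℕ.≟ r)} {λ S → 𝟙 (∣ S ∣ ℕ.≟ suc r)} (λ _ → ≤-refl) (λ _ → ≤-refl) ⟩
  _                  ≤⟨ +-mono-≤ (#size≤C n r) (#size≤C n (suc r)) ⟩
  n C r + n C suc r  ≡⟨ nCk+nC[k+1]≡[n+1]C[k+1] n r ⟩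
  suc n C suc r      ∎
  where open ≤-Reasoning

-- Cliques

allB⁺ : (p : A → Bool) (xs : List A) → (∀ x → p x ≡ true) → allB p xs ≡ true
allB⁺ p []       h = refl
allB⁺ p (x ∷ xs) h = cong₂ _∧_ (h x) (allB⁺ p xs h)

allB⁻ : (p : A → Bool) {xs : List A} → allB p xs ≡ true → ∀ {x} → x List.∈ xs → p x ≡ true
allB⁻ p {x ∷ xs} h (here refl) with p x
... | true = refl
allB⁻ p {y ∷ xs} h (there x∈)  with p y
... | true = allB⁻ p h x∈

Clique : (Fin n → Fin n → Bool) → Subset n → Set
Clique a S = ∀ i j → i ∈ S → j ∈ S → i ≢ j → a i j ≡ true

isClique⁺ : (a : Fin n → Fin n → Bool) (S : Subset n) → Clique a S → isClique a S ≡ true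
isClique⁺ {n} a S cl = allB⁺ _ (allFin n) λ i → allB⁺ _ (allFin n) λ j → lemma i j
  where
  lemma : ∀ i j → not (lookup S i ∧ lookup S j ∧ not (does (i ≟ j))) ∨ a i j ≡ true
  lemma i j with lookup S i in eqi | lookup S j in eqj | i ≟ j
  ... | false | _     | _      = refl
  ... | true  | false | _      = refl
  ... | true  | true  | yes _  = refl
  ... | true  | true  | no i≢j = cl i j (lookup⇒[]= i S eqi) (lookup⇒[]= j S eqj) i≢j

isClique⁻ : (a : Fin n → Fin n → Bool) (S : Subset n) → isClique a S ≡ true → Clique a S
isClique⁻ a S h i j i∈S j∈S i≢j with allB⁻ _ (allB⁻ _ h (∈-allFin i)) (∈-allFin j)
... | eq rewrite []=⇒lookup i∈S | []=⇒lookup j∈S | dec-false (i ≟ j) i≢j = eq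

IsK : ℕ → Graph n → Subset n → Set
IsK r G S = ∣ S ∣ ≡ r × Clique (adj G) S

-- Obtained by `map′` from the Boolean test inside `numK`, so that its `does` reduces to that test
-- and `numK` is a sum of these indicators.
isK? : (r : ℕ) (G : Graph n) (S : Subset n) → Dec (IsK r G S)
isK? r G S = map′
  (λ t → let t₁ , t₂ = Equivalence.to T-∧ t in
    ≡ᵇ⇒≡ ∣ S ∣ r t₁ , isClique⁻ (adj G) S (Equivalence.to T-≡ t₂))
  (λ (eq , cl) → Equivalence.from T-∧ (≡⇒≡ᵇ ∣ S ∣ r eq , Equivalence.from T-≡ (isClique⁺ (adj G) S cl)))
  (T? ((∣ S ∣ ≡ᵇ r) ∧ isClique (adj G) S))

numK≡∑ : (r : ℕ) (G : Graph n) → numK r G ≡ ∑ˢ (λ S → 𝟙 (isK? r G S))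
numK≡∑ {n} r G = length-filterᵇ _ (allSubsets n)

Clique-⊆ : {a : Fin n → Fin n → Bool} {S U : Subset n} → S ⊆ U → Clique a U → Clique a S
Clique-⊆ S⊆U cl i j i∈S j∈S = cl i j (S⊆U i∈S) (S⊆U j∈S)

addEdge⁻ : (a : Fin n → Fin n → Bool) (u v i j : Fin n) → addEdge a u v i j ≡ true →
           a i j ≡ true ⊎ (i ≡ u × j ≡ v) ⊎ (i ≡ v × j ≡ u)
addEdge⁻ a u v i j eq with a i j | i ≟ u | j ≟ v | i ≟ v | j ≟ u
... | true  | _       | _       | _       | _       = inj₁ refl
... | false | yes i≡u | yes j≡v | _       | _       = inj₂ (inj₁ (i≡u , j≡v))
... | false | _       | _       | yes i≡v | yes j≡u = inj₂ (inj₂ (i≡v , j≡u))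
... | false | no _    | _       | no _    | _       = inj₁ eq
... | false | no _    | _       | yes _   | no _    = inj₁ eq
... | false | yes _   | no _    | no _    | _       = inj₁ eq
... | false | yes _   | no _    | yes _   | no _    = inj₁ eq

-- The only pair of the clique that can fail to be an edge before the addition is `uv` itself, and
-- deleting either end removes that pair.
addEdge-delete : (a : Fin n → Fin n → Bool) {u v : Fin n} {S : Subset n} →
                 Clique (addEdge a u v) S → ∀ x → x ≡ u ⊎ x ≡ v → Clique a (S - x)
addEdge-delete a {u} {v} {S} cl x x≡u⊎v i j i∈ j∈ i≢j
  with addEdge⁻ a u v i j (cl i j (p─q⊆p S ⁅ x ⁆ i∈) (p─q⊆p S ⁅ x ⁆ j∈) i≢j) | x≡u⊎v
... | inj₁ eq                   | _         = eq
... | inj₂ (inj₁ (refl , refl)) | inj₁ refl = contradiction refl (x∈p-y⇒x≢y {p = S} i∈)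
... | inj₂ (inj₁ (refl , refl)) | inj₂ refl = contradiction refl (x∈p-y⇒x≢y {p = S} j∈)
... | inj₂ (inj₂ (refl , refl)) | inj₁ refl = contradiction refl (x∈p-y⇒x≢y {p = S} j∈)
... | inj₂ (inj₂ (refl , refl)) | inj₂ refl = contradiction refl (x∈p-y⇒x≢y {p = S} i∈)

-- Masking the diagonal lets any symmetric Boolean relation define a graph, whatever its values on
-- equal arguments.
symmetricGraph : (f : Fin n → Fin n → Bool) → (∀ i j → f i j ≡ f j i) → Graph n
symmetricGraph {n} f f-sym = record { adj = a ; sym = a-sym ; irrefl = a-irrefl }
  where
  a : Fin n → Fin n → Bool
  a i j = not (does (i ≟ j)) ∧ f i j
  a-sym : ∀ i j → a i j ≡ a j i
  a-sym i j with i ≟ j | j ≟ i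
  ... | yes _   | yes _   = refl
  ... | yes i≡j | no j≢i  = contradiction (≡-sym i≡j) j≢i
  ... | no i≢j  | yes j≡i = contradiction (≡-sym j≡i) i≢j
  ... | no _    | no _    = f-sym i j
  a-irrefl : ∀ i → a i i ≡ false
  a-irrefl i rewrite dec-true (i ≟ i) refl = refl

-- The upper bound: a complete graph joined to an independent set

apexGraph : (n t : ℕ) → Graph n
apexGraph n t = symmetricGraph (λ i j → (toℕ i ℕ.<ᵇ t) ∨ (toℕ j ℕ.<ᵇ t)) (λ i j → ∨-comm (toℕ i ℕ.<ᵇ t) _)

apexAdj⁻ : ∀ t {i j : Fin n} → adj (apexGraph n t) i j ≡ true → toℕ i < t ⊎ toℕ j < t
apexAdj⁻ t {i} {j} eq =
  Sum.map (<ᵇ⇒< (toℕ i) t) (<ᵇ⇒< (toℕ j) t)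
    (Equivalence.to T-∨ (proj₂ (Equivalence.to (T-∧ {not (does (i ≟ j))}) (Equivalence.from T-≡ eq))))

apexAdj⁺ : ∀ t {i j : Fin n} → i ≢ j → toℕ i < t ⊎ toℕ j < t → adj (apexGraph n t) i j ≡ true
apexAdj⁺ t {i} {j} i≢j i<t⊎j<t rewrite dec-false (i ≟ j) i≢j =
  Equivalence.to T-≡ (Equivalence.from T-∨ (Sum.map <⇒<ᵇ <⇒<ᵇ i<t⊎j<t))

initialSegment : (n t : ℕ) → Subset n
initialSegment n       zero    = ⊥
initialSegment zero    (suc t) = []
initialSegment (suc n) (suc t) = true ∷ initialSegment n t

∣initialSegment∣ : ∀ {n t} → t ≤ n → ∣ initialSegment n t ∣ ≡ t
∣initialSegment∣ {n} z≤n   = ∣⊥∣≡0 n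
∣initialSegment∣ (s≤s t≤n) = cong suc (∣initialSegment∣ t≤n)

∈-initialSegment⁻ : ∀ {n} t {i : Fin n} → i ∈ initialSegment n t → toℕ i < t
∈-initialSegment⁻ {n}     zero    i∈         = contradiction i∈ ∉⊥
∈-initialSegment⁻ {suc n} (suc t) here       = z<s
∈-initialSegment⁻ {suc n} (suc t) (there i∈) = s≤s (∈-initialSegment⁻ t i∈)

-- Distinct non-adjacent vertices both lie in the independent part, so the `t` vertices of the
-- complete part together with `u` and `v` form a clique once `uv` is added.
apex-saturated : ∀ {n t} → t ≤ n → StronglySat (suc (suc t)) (apexGraph n t)
apex-saturated {n} {t} t≤n u v u≢v uv≡false =
  S , ∣S∣ , x∈p∪q⁺ (inj₁ (x∈p∪q⁺ (inj₂ (x∈⁅x⁆ u)))) , x∈p∪q⁺ (inj₂ (x∈⁅x⁆ v)) ,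
  isClique⁺ _ S clique
  where
  I = initialSegment n t
  S = (I ∪ ⁅ u ⁆) ∪ ⁅ v ⁆

  ≮t : ∀ x → x ≡ u ⊎ x ≡ v → ¬ (toℕ x < t)
  ≮t x (inj₁ refl) x<t with () ← trans (≡-sym uv≡false) (apexAdj⁺ t u≢v (inj₁ x<t))
  ≮t x (inj₂ refl) x<t with () ← trans (≡-sym uv≡false) (apexAdj⁺ t u≢v (inj₂ x<t))

  v∉I∪u : v ∉ I ∪ ⁅ u ⁆
  v∉I∪u v∈ with x∈p∪q⁻ I ⁅ u ⁆ v∈
  ... | inj₁ v∈I = ≮t v (inj₂ refl) (∈-initialSegment⁻ t v∈I)
  ... | inj₂ v∈u = u≢v (≡-sym (x∈⁅y⁆⇒x≡y u v∈u))

  ∣S∣ : ∣ S ∣ ≡ suc (suc t)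
  ∣S∣ = trans (∣p∪⁅x⁆∣≡1+∣p∣ (I ∪ ⁅ u ⁆) v∉I∪u)
       (cong suc (trans (∣p∪⁅x⁆∣≡1+∣p∣ I (≮t u (inj₁ refl) ∘ ∈-initialSegment⁻ t))
                        (cong suc (∣initialSegment∣ t≤n))))

  cases : ∀ {i} → i ∈ S → toℕ i < t ⊎ i ≡ u ⊎ i ≡ v
  cases i∈S with x∈p∪q⁻ (I ∪ ⁅ u ⁆) ⁅ v ⁆ i∈S
  ... | inj₂ i∈v = inj₂ (inj₂ (x∈⁅y⁆⇒x≡y v i∈v))
  ... | inj₁ i∈Iu with x∈p∪q⁻ I ⁅ u ⁆ i∈Iu
  ... | inj₁ i∈I = inj₁ (∈-initialSegment⁻ t i∈I)
  ... | inj₂ i∈u = inj₂ (inj₁ (x∈⁅y⁆⇒x≡y u i∈u))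

  a = adj (apexGraph n t)

  a⇒ : ∀ {i j} → a i j ≡ true → addEdge a u v i j ≡ true
  a⇒ eq rewrite eq = refl

  uv∈ : addEdge a u v u v ≡ true
  uv∈ rewrite dec-true (u ≟ u) refl | dec-true (v ≟ v) refl = ∨-zeroʳ (a u v)

  vu∈ : addEdge a u v v u ≡ true
  vu∈ rewrite dec-true (u ≟ u) refl | dec-true (v ≟ v) refl =
    trans (cong (a v u ∨_) (∨-zeroʳ _)) (∨-zeroʳ (a v u))

  clique : Clique (addEdge a u v) S
  clique i j i∈S j∈S i≢j with cases i∈S | cases j∈S
  ... | inj₁ i<t         | _                = a⇒ (apexAdj⁺ t i≢j (inj₁ i<t))
  ... | inj₂ _           | inj₁ j<t         = a⇒ (apexAdj⁺ t i≢j (inj₂ j<t))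
  ... | inj₂ (inj₁ refl) | inj₂ (inj₁ refl) = contradiction refl i≢j
  ... | inj₂ (inj₁ refl) | inj₂ (inj₂ refl) = uv∈
  ... | inj₂ (inj₂ refl) | inj₂ (inj₁ refl) = vu∈
  ... | inj₂ (inj₂ refl) | inj₂ (inj₂ refl) = contradiction refl i≢j

TailPair : ℕ → Subset n → Set
TailPair t S = ∀ i j → i ∈ S → j ∈ S → i ≢ j → toℕ i < t ⊎ toℕ j < t

-- The number of members of `S` in the independent part of the apex graph. The recursion lets an
-- induction strip one vertex of the complete part at a time.
tailSize : ℕ → Subset n → ℕ
tailSize zero    S       = ∣ S ∣
tailSize (suc t) []      = 0
tailSize (suc t) (_ ∷ S) = tailSize t S

apexClique? : (t r : ℕ) (S : Subset n) → Dec (∣ S ∣ ≡ r × tailSize t S ≤ 1)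
apexClique? t r S = (∣ S ∣ ℕ.≟ r) ×-dec (tailSize t S ≤? 1)

tailSize≤1 : ∀ t (S : Subset n) → TailPair t S → tailSize t S ≤ 1
tailSize≤1 zero    S       tp = ≮⇒≥ λ 1<∣S∣ → case (2≤∣p∣⇒∃∈₂ S 1<∣S∣)
  where
  case : ¬ (∃ λ x → ∃ λ y → x ∈ S × y ∈ S × x ≢ y)
  case (x , y , x∈ , y∈ , x≢y) with tp x y x∈ y∈ x≢y
  ... | inj₁ ()
  ... | inj₂ ()
tailSize≤1 (suc t) []      tp = z≤n
tailSize≤1 (suc t) (_ ∷ S) tp = tailSize≤1 t S λ i j i∈ j∈ i≢j →
  Sum.map ≤-pred ≤-pred (tp (suc i) (suc j) (there i∈) (there j∈) λ { refl → i≢j refl })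

-- The first term bounds the sets with one vertex in the independent part, the second those with
-- none. The induction removes a vertex of the complete part and applies Pascal's rule to both
-- terms.
#apexCliques≤ : ∀ n t r → ∑ˢ {n} (λ S → 𝟙 (apexClique? t (suc r) S)) ≤ n * (t C r) + t C suc r
#apexCliques≤ n zero zero = begin
  _          ≤⟨ ∑-mono (allSubsets n) (λ S → 𝟙-mono (apexClique? 0 1 S) (∣ S ∣ ℕ.≟ 1) proj₁) ⟩
  _          ≤⟨ #size≤C n 1 ⟩
  n C 1      ≡⟨ nC1≡n n ⟩
  n          ≡⟨ *-identityʳ n ⟨
  n * 1      ≡⟨ +-identityʳ (n * 1) ⟨
  n * 1 + 0  ∎
  where open ≤-Reasoning
#apexCliques≤ n zero (suc r) = ≤-trans (≤-reflexive (trans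
  (∑-cong (allSubsets n) λ S → 𝟙-no (apexClique? 0 (suc (suc r)) S)
    λ { (eq , le) → contradiction (≤-trans (≤-reflexive (≡-sym eq)) le) λ { (s≤s ()) } })
  (∑-zero (allSubsets n)))) z≤n
#apexCliques≤ zero    (suc t) r = z≤n
#apexCliques≤ (suc n) (suc t) zero = begin
  _                             ≤⟨ ∑ˢ-suc-≤ {n} _ {λ S → 𝟙 (∣ S ∣ ℕ.≟ 0)} {λ S → 𝟙 (apexClique? t 1 S)}
    (λ S → 𝟙-mono (apexClique? (suc t) 1 (true ∷ S)) (∣ S ∣ ℕ.≟ 0) (suc-injective ∘ proj₁))
    (λ S → 𝟙-mono (apexClique? (suc t) 1 (false ∷ S)) (apexClique? t 1 S) id) ⟩
  _                             ≤⟨ +-mono-≤ (#size≤C n 0) (#apexCliques≤ n t 0) ⟩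
  1 + (n * 1 + t C 1)           ≤⟨ +-monoʳ-≤ 1 (+-monoʳ-≤ (n * 1) (≤-trans (m≤n+m _ _) (≤-reflexive (nCk+nC[k+1]≡[n+1]C[k+1] t 0)))) ⟩
  suc n * 1 + suc t C 1         ∎
  where open ≤-Reasoning
#apexCliques≤ (suc n) (suc t) (suc r) = begin
  _ ≤⟨ ∑ˢ-suc-≤ {n} _ {λ S → 𝟙 (apexClique? t (suc r) S)} {λ S → 𝟙 (apexClique? t (suc (suc r)) S)}
    (λ S → 𝟙-mono (apexClique? (suc t) (suc (suc r)) (true ∷ S)) (apexClique? t (suc r) S)
      λ { (eq , le) → suc-injective eq , le })
    (λ S → 𝟙-mono (apexClique? (suc t) (suc (suc r)) (false ∷ S)) (apexClique? t (suc (suc r)) S) id) ⟩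
  _ ≤⟨ +-mono-≤ (#apexCliques≤ n t r) (#apexCliques≤ n t (suc r)) ⟩
  (n * (t C r) + t C suc r) + (n * (t C suc r) + t C suc (suc r))
    ≡⟨ interchange (n * (t C r)) _ _ _ ⟩
  (n * (t C r) + n * (t C suc r)) + (t C suc r + t C suc (suc r))
    ≡⟨ cong₂ _+_ (≡-sym (*-distribˡ-+ n (t C r) _)) (nCk+nC[k+1]≡[n+1]C[k+1] t (suc r)) ⟩
  n * (t C r + t C suc r) + suc t C suc (suc r)
    ≡⟨ cong (λ c → n * c + suc t C suc (suc r)) (nCk+nC[k+1]≡[n+1]C[k+1] t r) ⟩
  n * (suc t C suc r) + suc t C suc (suc r)
    -- The removed vertex is not in the independent part, so the factor `n` would do; it is weakened
    -- to `suc n` to match the statement.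
    ≤⟨ +-monoˡ-≤ (suc t C suc (suc r)) (m≤n+m (n * (suc t C suc r)) (suc t C suc r)) ⟩
  suc n * (suc t C suc r) + suc t C suc (suc r) ∎
  where open ≤-Reasoning

numK-apex≤ : ∀ n t r → numK (suc r) (apexGraph n t) ≤ n * (t C r) + t C suc r
numK-apex≤ n t r = begin
  numK (suc r) (apexGraph n t) ≡⟨ numK≡∑ (suc r) (apexGraph n t) ⟩
  _ ≤⟨ ∑-mono (allSubsets n) (λ S → 𝟙-mono (isK? (suc r) (apexGraph n t) S) (apexClique? t (suc r) S)
         λ { (eq , cl) → eq , tailSize≤1 t S λ i j i∈ j∈ i≢j → apexAdj⁻ t (cl i j i∈ j∈ i≢j) }) ⟩
  _ ≤⟨ #apexCliques≤ n t r ⟩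
  n * (t C r) + t C suc r      ∎
  where open ≤-Reasoning

-- The minimum is attained

leastWitness : {P : ℕ → Set} → (∀ m → Dec (P m)) → ∀ {m} → P m →
               ∃ λ l → P l × (∀ j → P j → l ≤ j)
leastWitness {P} P? {m} = <-rec (λ m → P m → ∃ λ l → P l × (∀ j → P j → l ≤ j)) step m
  where
  step : ∀ m → (∀ {i} → i < m → P i → ∃ λ l → P l × (∀ j → P j → l ≤ j)) →
         P m → ∃ λ l → P l × (∀ j → P j → l ≤ j)
  step m rec pm with anyUpTo? P? m
  ... | yes (i , i<m , pi) = rec i<m pi
  ... | no ∄i              = m , pm , λ j pj → ≮⇒≥ λ j<m → ∄i (j , j<m , pj)

-- Graphs contain functions, so they are compared pointwise instead of by propositional equality,
-- which would call for function extensionality.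
_≈ᴳ_ : Graph n → Graph n → Set
G ≈ᴳ H = ∀ i j → adj G i j ≡ adj H i j

numK-cong : ∀ r {G H : Graph n} → G ≈ᴳ H → numK r G ≡ numK r H
numK-cong {n} r {G} {H} G≈H = trans (numK≡∑ r G) (trans
  (≤-antisym (≤H {G} {H} G≈H) (≤H {H} {G} (λ i j → ≡-sym (G≈H i j)))) (≡-sym (numK≡∑ r H)))
  where
  ≤H : ∀ {G H : Graph n} → G ≈ᴳ H → ∑ˢ (λ S → 𝟙 (isK? r G S)) ≤ ∑ˢ (λ S → 𝟙 (isK? r H S))
  ≤H {G} {H} eq = ∑-mono (allSubsets n) λ S → 𝟙-mono (isK? r G S) (isK? r H S)
    λ (∣S∣ , cl) → ∣S∣ , λ i j i∈ j∈ i≢j → trans (≡-sym (eq i j)) (cl i j i∈ j∈ i≢j)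

StronglySat-cong : ∀ s {G H : Graph n} → G ≈ᴳ H → StronglySat s G → StronglySat s H
StronglySat-cong s {G} {H} G≈H sat u v u≢v uv with sat u v u≢v (trans (G≈H u v) uv)
... | S , ∣S∣ , u∈ , v∈ , cl = S , ∣S∣ , u∈ , v∈ , isClique⁺ _ S λ i j i∈ j∈ i≢j →
  trans (cong (_∨ _) (≡-sym (G≈H i j))) (isClique⁻ _ S cl i j i∈ j∈ i≢j)

stronglySat? : ∀ s (G : Graph n) → Dec (StronglySat s G)
stronglySat? s G = all? λ u → all? λ v → ¬? (u ≟ v) →-dec ((adj G u v Bool.≟ false) →-dec
  anySubset? λ S → (∣ S ∣ ℕ.≟ s) ×-dec ((u ∈? S) ×-dec ((v ∈? S) ×-dec
    (isClique (addEdge (adj G) u v) S Bool.≟ true))))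

-- A subset of the `n * n` matrix positions is read as an adjacency matrix. Symmetrising it and
-- masking the diagonal makes every subset a valid code, so a search over graphs becomes a search
-- over subsets.
decode : Subset (n * n) → Graph n
decode X = symmetricGraph (λ i j → lookup X (combine i j) ∨ lookup X (combine j i))
                          (λ i j → ∨-comm (lookup X (combine i j)) _)

encode : Graph n → Subset (n * n)
encode {n} G = tabulate λ x → adj G (proj₁ (remQuot {n} n x)) (proj₂ (remQuot {n} n x))

lookup-encode : (G : Graph n) (i j : Fin n) → lookup (encode G) (combine i j) ≡ adj G i j
lookup-encode {n} G i j = trans (lookup∘tabulate _ (combine i j))
  (cong (λ p → adj G (proj₁ p) (proj₂ p)) (remQuot-combine i j))

decode-encode : (G : Graph n) → decode (encode G) ≈ᴳ G
decode-encode G i j rewrite lookup-encode G i j | lookup-encode G j i with i ≟ j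
... | yes refl = ≡-sym (irrefl G i)
... | no _     = trans (cong (adj G i j ∨_) (sym G j i)) (∨-idem (adj G i j))

-- Whether a value is attained is decidable by searching all adjacency matrices. The given graph
-- attains some value, so there is a least one.
ssat-exists : ∀ r s (G : Graph n) → StronglySat s G → ∃ λ m → IsSsat n r s m
ssat-exists {n} r s G₀ sat₀ with leastWitness attained? (G₀ , sat₀ , refl)
  where
  attained? : ∀ m → Dec (Σ (Graph n) λ G → StronglySat s G × numK r G ≡ m)
  attained? m = map′
    (λ (X , sat , eq) → decode X , sat , eq)
    (λ (G , sat , eq) → let G≈ = λ i j → ≡-sym (decode-encode G i j) in
      encode G , StronglySat-cong s {G} {decode (encode G)} G≈ sat , trans (≡-sym (numK-cong r {G} {decode (encode G)} G≈)) eq)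
    (anySubset? λ X → stronglySat? s (decode {n} X) ×-dec (numK r (decode {n} X) ℕ.≟ m))
... | m , att , least = m , att , λ G sat → least (numK r G) (G , sat , refl)

-- The lower bound

-- Indices are shifted: R = r + 1 and t + 2 are the paper's r and s.
module LowerBound (r t : ℕ) (1≤r : 1 ≤ r) (r≤t : r ≤ t)
                  (G : Graph n) (sat : StronglySat (suc (suc t)) G) (D : ℕ) where

  -- Copies of `K_R` through one or two vertices

  R : ℕ
  R = suc r

  K? : (S : Subset n) → Dec (IsK R G S)
  K? = isK? R G

  -- The degree in the hypergraph of copies of `K_R`, not the degree in `G`; `codeg` below belongs
  -- to the same hypergraph, and `codeg v v` has the value `deg v`.
  deg : Fin n → ℕ
  deg v = ∑ˢ λ S → 𝟙 (K? S) * 𝟙 (v ∈? S)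

  codeg : Fin n → Fin n → ℕ
  codeg v w = ∑ˢ λ S → 𝟙 (K? S) * 𝟙 (v ∈? S) * 𝟙 (w ∈? S)

  𝟙K*∣S∣ : ∀ S → 𝟙 (K? S) * ∣ S ∣ ≡ 𝟙 (K? S) * R
  𝟙K*∣S∣ S = 𝟙*-cong (K? S) proj₁

  ∑deg : ∑ᶠ deg ≡ numK R G * R
  ∑deg = begin
    ∑ᶠ deg                                              ≡⟨ ∑-swap (allFin n) (allSubsets n) _ ⟩
    ∑ˢ (λ S → ∑ᶠ λ v → 𝟙 (K? S) * 𝟙 (v ∈? S))           ≡⟨ ∑-cong (allSubsets n) (λ S → ∑-*ˡ (allFin n) (𝟙 (K? S)) _) ⟩
    ∑ˢ (λ S → 𝟙 (K? S) * ∑ᶠ λ v → 𝟙 (v ∈? S))           ≡⟨ ∑-cong (allSubsets n) (λ S → cong (𝟙 (K? S) *_) (≡-sym (∣S∣≡∑ S))) ⟩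
    ∑ˢ (λ S → 𝟙 (K? S) * ∣ S ∣)                         ≡⟨ ∑-cong (allSubsets n) 𝟙K*∣S∣ ⟩
    ∑ˢ (λ S → 𝟙 (K? S) * R)                             ≡⟨ ∑-*ʳ (allSubsets n) _ R ⟩
    ∑ˢ (λ S → 𝟙 (K? S)) * R                             ≡⟨ cong (_* R) (≡-sym (numK≡∑ R G)) ⟩
    numK R G * R                                        ∎
    where open ≡-Reasoning

  -- Each copy through `v` is counted once for each of its `R` vertices, `v` included. Hence at most
  -- `deg v * R` vertices share a copy with `v`.
  ∑codeg : ∀ v → ∑ᶠ (codeg v) ≡ deg v * R
  ∑codeg v = begin
    ∑ᶠ (codeg v)                                        ≡⟨ ∑-swap (allFin n) (allSubsets n) _ ⟩
    ∑ˢ (λ S → ∑ᶠ λ w → 𝟙 (K? S) * 𝟙 (v ∈? S) * 𝟙 (w ∈? S))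
      ≡⟨ ∑-cong (allSubsets n) (λ S → ∑-*ˡ (allFin n) (𝟙 (K? S) * 𝟙 (v ∈? S)) _) ⟩
    ∑ˢ (λ S → 𝟙 (K? S) * 𝟙 (v ∈? S) * ∑ᶠ λ w → 𝟙 (w ∈? S))
      ≡⟨ ∑-cong (allSubsets n) (λ S → trans (cong (𝟙 (K? S) * 𝟙 (v ∈? S) *_) (≡-sym (∣S∣≡∑ S)))
                                           (swap (𝟙 (K? S)) (𝟙 (v ∈? S)) ∣ S ∣)) ⟩
    ∑ˢ (λ S → 𝟙 (K? S) * ∣ S ∣ * 𝟙 (v ∈? S))
      ≡⟨ ∑-cong (allSubsets n) (λ S → trans (cong (_* 𝟙 (v ∈? S)) (𝟙K*∣S∣ S)) (swap (𝟙 (K? S)) R (𝟙 (v ∈? S)))) ⟩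
    ∑ˢ (λ S → 𝟙 (K? S) * 𝟙 (v ∈? S) * R)                ≡⟨ ∑-*ʳ (allSubsets n) _ R ⟩
    deg v * R                                           ∎
    where
    open ≡-Reasoning
    swap : ∀ a b c → a * b * c ≡ a * c * b
    swap = solve-∀

  ∈K⇒codeg≥1 : ∀ {S} → IsK R G S → ∀ {v w} → v ∈ S → w ∈ S → 1 ≤ codeg v w
  ∈K⇒codeg≥1 {S} k {v} {w} v∈S w∈S = begin
    1                                   ≡⟨ cong₂ _*_ (cong₂ _*_ (𝟙-yes (K? S) k) (𝟙-yes (v ∈? S) v∈S)) (𝟙-yes (w ∈? S) w∈S) ⟨
    𝟙 (K? S) * 𝟙 (v ∈? S) * 𝟙 (w ∈? S)  ≤⟨ ∈⇒≤∑ (λ S → 𝟙 (K? S) * 𝟙 (v ∈? S) * 𝟙 (w ∈? S)) (∈-allSubsets S) ⟩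
    codeg v w                           ∎
    where open ≤-Reasoning

  -- Since `R` is at least 2, the set formed by `v` and `w` extends inside `U` to `R` vertices,
  -- which are again a clique. The case `v = w` is included.
  codeg≥1 : ∀ {U} → Clique (adj G) U → R ≤ ∣ U ∣ → ∀ {v w} → v ∈ U → w ∈ U → 1 ≤ codeg v w
  codeg≥1 {U} cl R≤∣U∣ {v} {w} v∈U w∈U =
    let S , X⊆S , S⊆U , ∣S∣ = ⊆-interpolate (⁅ v ⁆ ∪ ⁅ w ⁆) U R (X⊆U ∘ x∈p∪q⁻ ⁅ v ⁆ ⁅ w ⁆) ∣X∣≤R R≤∣U∣ in
    ∈K⇒codeg≥1 (∣S∣ , Clique-⊆ S⊆U cl) (X⊆S (x∈p∪q⁺ (inj₁ (x∈⁅x⁆ v)))) (X⊆S (x∈p∪q⁺ (inj₂ (x∈⁅x⁆ w))))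
    where
    X⊆U : ∀ {x} → x ∈ ⁅ v ⁆ ⊎ x ∈ ⁅ w ⁆ → x ∈ U
    X⊆U (inj₁ x∈) rewrite x∈⁅y⁆⇒x≡y v x∈ = v∈U
    X⊆U (inj₂ x∈) rewrite x∈⁅y⁆⇒x≡y w x∈ = w∈U
    ∣X∣≤R : ∣ ⁅ v ⁆ ∪ ⁅ w ⁆ ∣ ≤ R
    ∣X∣≤R = ≤-trans (∣p∪q∣≤∣p∣+∣q∣ ⁅ v ⁆ ⁅ w ⁆)
      (≤-trans (≤-reflexive (cong₂ _+_ (∣⁅x⁆∣≡1 v) (∣⁅x⁆∣≡1 w))) (s≤s 1≤r))

  -- Heavy vertices

  Heavy : Fin n → Set
  Heavy v = D ≤ deg v

  heavy? : ∀ v → Dec (Heavy v)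
  heavy? v = D ≤? deg v

  #heavy : ℕ
  #heavy = ∑ᶠ λ v → 𝟙 (heavy? v)

  -- Markov's inequality for `deg`.
  #heavy*D≤ : #heavy * D ≤ numK R G * R
  #heavy*D≤ = begin
    #heavy * D                     ≡⟨ ∑-*ʳ (allFin n) _ D ⟨
    ∑ᶠ (λ v → 𝟙 (heavy? v) * D)    ≤⟨ ∑-mono (allFin n) (λ v → 𝟙*-≤ (heavy? v) id) ⟩
    ∑ᶠ deg                         ≡⟨ ∑deg ⟩
    numK R G * R                   ∎
    where open ≤-Reasoning

  -- Pendant copies of `K_R`

  Pendant : Fin n → Subset n → Set
  Pendant v S = v ∈ S × (∀ w → w ∈ S → w ≢ v → Heavy w)

  pendant? : ∀ v S → Dec (Pendant v S)
  pendant? v S = (v ∈? S) ×-dec all? λ w → (w ∈? S) →-dec (¬? (w ≟ v) →-dec heavy? w)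

  pendants : Fin n → ℕ
  pendants v = ∑ˢ λ S → 𝟙 (K? S) * 𝟙 (pendant? v S)

  light? : ∀ v → Dec (¬ Heavy v)
  light? v = ¬? (heavy? v)

  -- A copy of K_R is pendant at no more than one light vertex.
  ∑pendants≤ : ∑ᶠ (λ v → 𝟙 (light? v) * pendants v) ≤ numK R G
  ∑pendants≤ = begin
    ∑ᶠ (λ v → 𝟙 (light? v) * pendants v)
      ≡⟨ ∑-cong (allFin n) (λ v → ≡-sym (∑-*ˡ (allSubsets n) (𝟙 (light? v)) _)) ⟩
    ∑ᶠ (λ v → ∑ˢ λ S → 𝟙 (light? v) * (𝟙 (K? S) * 𝟙 (pendant? v S)))
      ≡⟨ ∑-swap (allFin n) (allSubsets n) _ ⟩
    ∑ˢ (λ S → ∑ᶠ λ v → 𝟙 (light? v) * (𝟙 (K? S) * 𝟙 (pendant? v S)))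
      ≡⟨ ∑-cong (allSubsets n) (λ S → ∑-cong (allFin n) (λ v → regroup S v)) ⟩
    ∑ˢ (λ S → ∑ᶠ λ v → 𝟙 (light? v ×-dec pendant? v S) * 𝟙 (K? S))
      ≡⟨ ∑-cong (allSubsets n) (λ S → ∑-*ʳ (allFin n) _ (𝟙 (K? S))) ⟩
    ∑ˢ (λ S → (∑ᶠ λ v → 𝟙 (light? v ×-dec pendant? v S)) * 𝟙 (K? S))
      ≤⟨ ∑-mono (allSubsets n) (λ S → ≤-trans (*-monoˡ-≤ (𝟙 (K? S)) (∑ᶠ-unique (λ v → light? v ×-dec pendant? v S) (unique S))) (≤-reflexive (*-identityˡ _))) ⟩
    ∑ˢ (λ S → 𝟙 (K? S))
      ≡⟨ numK≡∑ R G ⟨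
    numK R G ∎
    where
    open ≤-Reasoning
    assoc-swap : ∀ a b c → a * (b * c) ≡ a * c * b
    assoc-swap = solve-∀
    regroup : ∀ S v → 𝟙 (light? v) * (𝟙 (K? S) * 𝟙 (pendant? v S)) ≡ 𝟙 (light? v ×-dec pendant? v S) * 𝟙 (K? S)
    regroup S v = trans (assoc-swap (𝟙 (light? v)) (𝟙 (K? S)) (𝟙 (pendant? v S)))
                        (cong (_* 𝟙 (K? S)) (≡-sym (𝟙-× (light? v) (pendant? v S))))
    unique : ∀ S {u v} → ¬ Heavy u × Pendant u S → ¬ Heavy v × Pendant v S → u ≡ v
    unique S {u} {v} (lu , u∈S , _) (_ , _ , hv) = decidable-stable (u ≟ v) λ u≢v → lu (hv u u∈S u≢v)

  -- Any `r` of the other `t` vertices of `U`, all of them heavy, complete `v` to a pendant copy.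
  pendants≥C : ∀ {U v} → Clique (adj G) U → ∣ U ∣ ≡ suc t → Pendant v U → t C r ≤ pendants v
  pendants≥C {U} {v} cl ∣U∣ (v∈U , hv) = ≤-trans (C≤#⊆∋ U t r v∈U ∣U∣) (∑-mono (allSubsets n) λ S →
    𝟙-≤ ((v ∈? S) ×-dec (S ⊆[ R ]? U)) λ h → let ∣S∣ = proj₁ (proj₂ h) ; S⊆U : S ⊆ U ; S⊆U = proj₂ (proj₂ h) in
      ≤-reflexive (≡-sym (cong₂ _*_ (𝟙-yes (K? S) (∣S∣ , Clique-⊆ S⊆U cl))
        (𝟙-yes (pendant? v S) (proj₁ h , λ w w∈S → hv w (S⊆U w∈S))))))

  -- Bad vertices and their non-neighbours

  Bad : Fin n → Set
  Bad v = ¬ Heavy v × pendants v < t C r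

  bad? : ∀ v → Dec (Bad v)
  bad? v = light? v ×-dec (pendants v ℕ.<? t C r)

  #bad : ℕ
  #bad = ∑ᶠ λ v → 𝟙 (bad? v)

  light⇒deg≤D : ∀ v → ¬ Heavy v → deg v ≤ D
  light⇒deg≤D v lv = <⇒≤ (≰⇒> lv)

  nonadj? : ∀ v u → Dec (adj G v u ≡ false)
  nonadj? v u = adj G v u Bool.≟ false

  -- Saturation gives `t + 2` vertices that form a clique once `vu` is added. If all of them except
  -- `u` and `v` were heavy, deleting `u` would leave a clique providing `v` with too many pendant
  -- copies for a bad vertex; so there is a light `w` among them. Deleting `u`, respectively `v`,
  -- leaves a clique of `t + 1 ≥ R` vertices through `v` and `w`, respectively `w` and `u`.
  bad-path : ∀ {v u} → Bad v → v ≢ u → adj G v u ≡ false →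
             ∃ λ w → ¬ Heavy w × 1 ≤ codeg v w × 1 ≤ codeg w u
  bad-path {v} {u} (_ , few) v≢u nadj with sat v u v≢u nadj
  ... | S , ∣S∣ , v∈S , u∈S , isCl
    with any? (λ w → (w ∈? (S - u)) ×-dec (¬? (w ≟ v) ×-dec light? w))
  ... | yes (w , w∈ , w≢v , lw) = w , lw ,
          codeg≥1 cl-u (size u∈S) v∈S-u w∈ ,
          codeg≥1 cl-v (size v∈S) (x∈p∧x≢y⇒x∈p-y (p─q⊆p S ⁅ u ⁆ w∈) w≢v) (x∈p∧x≢y⇒x∈p-y u∈S (v≢u ∘ ≡-sym))
    where
    cl = isClique⁻ _ S isCl
    cl-u : Clique (adj G) (S - u)
    cl-u = addEdge-delete (adj G) cl u (inj₂ refl)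
    cl-v : Clique (adj G) (S - v)
    cl-v = addEdge-delete (adj G) cl v (inj₁ refl)
    v∈S-u : v ∈ S - u
    v∈S-u = x∈p∧x≢y⇒x∈p-y v∈S v≢u
    size : ∀ {x} → x ∈ S → R ≤ ∣ S - x ∣
    size x∈S = ≤-trans (s≤s r≤t) (≤-reflexive (suc-injective (trans (≡-sym ∣S∣) (∣p∣≡1+∣p-x∣ x∈S))))
  ... | no ∄w = contradiction
          (pendants≥C (addEdge-delete (adj G) (isClique⁻ _ S isCl) u (inj₂ refl))
            (suc-injective (trans (≡-sym (∣p∣≡1+∣p-x∣ u∈S)) ∣S∣))
            (x∈p∧x≢y⇒x∈p-y v∈S v≢u , λ w w∈ w≢v → decidable-stable (heavy? w) λ lw → ∄w (w , w∈ , w≢v , lw)))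
          (<⇒≱ few)

  -- Bounds the total conflict of a bad vertex: `D * R` accounts for codegrees, the rest for
  -- non-neighbours, the vertex itself among them.
  M : ℕ
  M = 1 + D * (D * R * R) + D * R

  -- Every non-neighbour is `v` itself or the end of a path from `bad-path`. Weighted by codegrees,
  -- the first steps of such paths total `deg v * R`, and each light middle vertex allows at most
  -- `D * R` second steps.
  #nonadj≤ : ∀ {v} → Bad v → ∑ᶠ (λ u → 𝟙 (nonadj? v u)) ≤ 1 + D * (D * R * R)
  #nonadj≤ {v} bv@(lv , _) = begin
    ∑ᶠ (λ u → 𝟙 (nonadj? v u))
      ≤⟨ ∑-mono (allFin n) pointwise ⟩
    ∑ᶠ (λ u → 𝟙 (u ≟ v) + ∑ᶠ λ w → codeg v w * (𝟙 (light? w) * codeg w u))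
      ≡⟨ ∑-+ (allFin n) _ _ ⟩
    ∑ᶠ (λ u → 𝟙 (u ≟ v)) + ∑ᶠ (λ u → ∑ᶠ λ w → codeg v w * (𝟙 (light? w) * codeg w u))
      ≡⟨ cong₂ _+_ (∑ᶠ-𝟙≟ v) (∑-swap (allFin n) (allFin n) _) ⟩
    1 + ∑ᶠ (λ w → ∑ᶠ λ u → codeg v w * (𝟙 (light? w) * codeg w u))
      ≤⟨ +-monoʳ-≤ 1 (∑-mono (allFin n) inner) ⟩
    1 + ∑ᶠ (λ w → codeg v w * (D * R))
      ≡⟨ cong suc (trans (∑-*ʳ (allFin n) (codeg v) (D * R)) (cong (_* (D * R)) (∑codeg v))) ⟩
    1 + deg v * R * (D * R)
      ≤⟨ +-monoʳ-≤ 1 (*-monoˡ-≤ (D * R) (*-monoˡ-≤ R (light⇒deg≤D v lv))) ⟩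
    1 + D * R * (D * R)
      ≡⟨ rearrange D R ⟩
    1 + D * (D * R * R) ∎
    where
    open ≤-Reasoning
    rearrange : ∀ d x → 1 + d * x * (d * x) ≡ 1 + d * (d * x * x)
    rearrange = solve-∀
    pointwise : ∀ u → 𝟙 (nonadj? v u) ≤ 𝟙 (u ≟ v) + ∑ᶠ λ w → codeg v w * (𝟙 (light? w) * codeg w u)
    pointwise u = 𝟙-≤ (nonadj? v u) go
      where
      go : adj G v u ≡ false → 1 ≤ 𝟙 (u ≟ v) + ∑ᶠ λ w → codeg v w * (𝟙 (light? w) * codeg w u)
      go nadj with u ≟ v
      ... | yes _   = s≤s z≤n
      ... | no u≢v with bad-path bv (u≢v ∘ ≡-sym) nadj
      ... | w , lw , c₁ , c₂ = ≤-trans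
        (*-mono-≤ c₁ (*-mono-≤ (≤-reflexive (≡-sym (𝟙-yes (light? w) lw))) c₂))
        (∈⇒≤∑ (λ w → codeg v w * (𝟙 (light? w) * codeg w u)) (∈-allFin w))
    inner : ∀ w → ∑ᶠ (λ u → codeg v w * (𝟙 (light? w) * codeg w u)) ≤ codeg v w * (D * R)
    inner w = begin
      ∑ᶠ (λ u → codeg v w * (𝟙 (light? w) * codeg w u))  ≡⟨ ∑-*ˡ (allFin n) (codeg v w) _ ⟩
      codeg v w * ∑ᶠ (λ u → 𝟙 (light? w) * codeg w u)    ≡⟨ cong (codeg v w *_) (∑-*ˡ (allFin n) (𝟙 (light? w)) _) ⟩
      codeg v w * (𝟙 (light? w) * ∑ᶠ (codeg w))          ≡⟨ cong (λ x → codeg v w * (𝟙 (light? w) * x)) (∑codeg w) ⟩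
      codeg v w * (𝟙 (light? w) * (deg w * R))           ≤⟨ *-monoʳ-≤ (codeg v w) bound ⟩
      codeg v w * (D * R)                                ∎
      where
      bound : 𝟙 (light? w) * (deg w * R) ≤ D * R
      bound = 𝟙*-≤ (light? w) λ lw → *-monoˡ-≤ R (light⇒deg≤D w lw)

  -- Conflicts and the greedy choice of bad vertices

  conflict : Fin n → Fin n → ℕ
  conflict u w = 𝟙 (nonadj? u w) + codeg u w

  ∑conflict≤M : ∀ {u} → Bad u → ∑ᶠ (conflict u) ≤ M
  ∑conflict≤M {u} bu@(lu , _) = begin
    ∑ᶠ (conflict u)                                ≡⟨ ∑-+ (allFin n) _ _ ⟩
    ∑ᶠ (λ w → 𝟙 (nonadj? u w)) + ∑ᶠ (codeg u)      ≤⟨ +-mono-≤ (#nonadj≤ bu) (≤-reflexive (∑codeg u)) ⟩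
    1 + D * (D * R * R) + deg u * R                ≤⟨ +-monoʳ-≤ (1 + D * (D * R * R)) (*-monoˡ-≤ R (light⇒deg≤D u lu)) ⟩
    M                                              ∎
    where open ≤-Reasoning

  conflict-sym : ∀ u w → conflict u w ≡ conflict w u
  conflict-sym u w = cong₂ _+_
    (cong (λ b → 𝟙 (b Bool.≟ false)) (sym G u w))
    (∑-cong (allSubsets n) λ S → swap (𝟙 (K? S)) (𝟙 (u ∈? S)) (𝟙 (w ∈? S)))
    where
    swap : ∀ a b c → a * b * c ≡ a * c * b
    swap = solve-∀

  -- A vertex is not adjacent to itself. Consequently a vertex without conflicts with a set lies
  -- outside it, and adding it enlarges the set.
  conflict-diag : ∀ u → conflict u u ≢ 0
  conflict-diag u eq with () ← trans (≡-sym (𝟙-yes (nonadj? u u) (irrefl G u))) (m+n≡0⇒m≡0 _ eq)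

  record Greedy (j : ℕ) : Set where
    field
      S        : Subset n
      ∣S∣≡j    : ∣ S ∣ ≡ j
      allBad   : ∀ u → u ∈ S → Bad u
      peaceful : ∀ u w → u ∈ S → w ∈ S → u ≢ w → conflict u w ≡ 0

  -- By double counting, the conflicts of all vertices with the `j` chosen ones total at most
  -- `j * M`. This is less than the number of bad vertices, so some bad vertex conflicts with none
  -- of the chosen ones.
  greedy-suc : ∀ {j} → j * M < #bad → Greedy j → Greedy (suc j)
  greedy-suc {j} lt g = record
    { S        = S ∪ ⁅ w ⁆
    ; ∣S∣≡j    = trans (∣p∪⁅x⁆∣≡1+∣p∣ S λ w∈S → conflict-diag w (no-conflict w w∈S)) (cong suc ∣S∣≡j)
    ; allBad   = λ u u∈ → bad′ u (x∈p∪q⁻ S ⁅ w ⁆ u∈)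
    ; peaceful = λ x y x∈ y∈ → peace x y (x∈p∪q⁻ S ⁅ w ⁆ x∈) (x∈p∪q⁻ S ⁅ w ⁆ y∈)
    }
    where
    open Greedy g
    total : Fin n → ℕ
    total w = ∑ᶠ λ u → 𝟙 (u ∈? S) * conflict u w

    small : ∑ᶠ total < #bad
    small = ≤-<-trans (begin
      ∑ᶠ total                                           ≡⟨ ∑-swap (allFin n) (allFin n) _ ⟩
      ∑ᶠ (λ u → ∑ᶠ λ w → 𝟙 (u ∈? S) * conflict u w)      ≡⟨ ∑-cong (allFin n) (λ u → ∑-*ˡ (allFin n) (𝟙 (u ∈? S)) _) ⟩
      ∑ᶠ (λ u → 𝟙 (u ∈? S) * ∑ᶠ (conflict u))            ≤⟨ ∑-mono (allFin n) (λ u → 𝟙*-mono (u ∈? S) (∑conflict≤M ∘ allBad u)) ⟩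
      ∑ᶠ (λ u → 𝟙 (u ∈? S) * M)                          ≡⟨ ∑-*ʳ (allFin n) _ M ⟩
      ∑ᶠ (λ u → 𝟙 (u ∈? S)) * M                          ≡⟨ cong (_* M) (trans (≡-sym (∣S∣≡∑ S)) ∣S∣≡j) ⟩
      j * M                                              ∎) lt
      where open ≤-Reasoning

    -- The comparison is with the indicator of `Bad`: `total w < 𝟙 (bad? w)` forces `w` to be bad
    -- and `total w` to vanish.
    chosen = ∑-<⇒∃< (allFin n) total _ small
    w = proj₁ chosen
    bw×0 = m<𝟙⇒m≡0 (bad? w) (proj₂ chosen)

    no-conflict : ∀ u → u ∈ S → conflict u w ≡ 0
    no-conflict u u∈S = n≤0⇒n≡0 (begin
      conflict u w                   ≡⟨ *-identityˡ _ ⟨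
      1 * conflict u w               ≡⟨ cong (_* conflict u w) (𝟙-yes (u ∈? S) u∈S) ⟨
      𝟙 (u ∈? S) * conflict u w      ≤⟨ ∈⇒≤∑ (λ u → 𝟙 (u ∈? S) * conflict u w) (∈-allFin u) ⟩
      total w                        ≡⟨ proj₂ bw×0 ⟩
      0                              ∎)
      where open ≤-Reasoning

    bad′ : ∀ u → u ∈ S ⊎ u ∈ ⁅ w ⁆ → Bad u
    bad′ u (inj₁ u∈S) = allBad u u∈S
    bad′ u (inj₂ u∈w) = subst Bad (≡-sym (x∈⁅y⁆⇒x≡y w u∈w)) (proj₁ bw×0)

    peace : ∀ x y → x ∈ S ⊎ x ∈ ⁅ w ⁆ → y ∈ S ⊎ y ∈ ⁅ w ⁆ → x ≢ y → conflict x y ≡ 0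
    peace x y (inj₁ x∈S) (inj₁ y∈S) x≢y = peaceful x y x∈S y∈S x≢y
    peace x y (inj₁ x∈S) (inj₂ y∈w) x≢y =
      subst (λ z → conflict x z ≡ 0) (≡-sym (x∈⁅y⁆⇒x≡y w y∈w)) (no-conflict x x∈S)
    peace x y (inj₂ x∈w) (inj₁ y∈S) x≢y =
      subst (λ z → conflict z y ≡ 0) (≡-sym (x∈⁅y⁆⇒x≡y w x∈w)) (trans (conflict-sym w y) (no-conflict y y∈S))
    peace x y (inj₂ x∈w) (inj₂ y∈w) x≢y = contradiction (trans (x∈⁅y⁆⇒x≡y w x∈w) (≡-sym (x∈⁅y⁆⇒x≡y w y∈w))) x≢y

  greedy : R * M < #bad → ∀ j → j ≤ R → Greedy j
  greedy lt zero    _   = record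
    { S = ⊥ ; ∣S∣≡j = ∣⊥∣≡0 n ; allBad = λ u u∈ → contradiction u∈ ∉⊥
    ; peaceful = λ u w u∈ → contradiction u∈ ∉⊥ }
  greedy lt (suc j) j<R = greedy-suc (≤-<-trans (*-monoˡ-≤ M (<⇒≤ j<R)) lt) (greedy lt j (<⇒≤ j<R))

  -- Otherwise the greedy choice yields `R` bad vertices without conflicts. Being pairwise adjacent,
  -- they form a copy of `K_R`, so any two of them have positive codegree, which is a conflict.
  #bad≤ : #bad ≤ R * M
  #bad≤ = ≮⇒≥ λ lt → absurd (greedy lt R ≤-refl)
    where
    absurd : ¬ Greedy R
    absurd g with 2≤∣p∣⇒∃∈₂ S (≤-trans (s≤s 1≤r) (≤-reflexive (≡-sym ∣S∣≡j)))
      where open Greedy g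
    ... | x , y , x∈ , y∈ , x≢y = <⇒≱ (codeg≥1 cl (≤-reflexive (≡-sym ∣S∣≡j)) x∈ y∈)
                                      (≤-reflexive (m+n≡0⇒n≡0 (𝟙 (nonadj? x y)) (peaceful x y x∈ y∈ x≢y)))
      where
      open Greedy g
      cl : Clique (adj G) S
      cl i j i∈ j∈ i≢j with adj G i j in eq
      ... | true  = refl
      ... | false with () ← trans (≡-sym (𝟙-yes (nonadj? i j) eq)) (m+n≡0⇒m≡0 _ (peaceful i j i∈ j∈ i≢j))

  -- The bound for a fixed threshold `D`

  nC≤ : n * (t C r) ≤ #heavy * (t C r) + #bad * (t C r) + numK R G
  nC≤ = begin
    n * c                       ≡⟨ ∑ᶠ-const n c ⟨
    ∑ᶠ {n} (λ _ → c)            ≤⟨ ∑-mono (allFin n) pointwise ⟩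
    ∑ᶠ (λ v → 𝟙 (heavy? v) * c + 𝟙 (bad? v) * c + 𝟙 (light? v) * pendants v)
      ≡⟨ trans (∑-+ (allFin n) _ _) (cong (_+ ∑ᶠ (λ v → 𝟙 (light? v) * pendants v))
           (trans (∑-+ (allFin n) _ _) (cong₂ _+_ (∑-*ʳ (allFin n) _ c) (∑-*ʳ (allFin n) _ c)))) ⟩
    #heavy * c + #bad * c + ∑ᶠ (λ v → 𝟙 (light? v) * pendants v)
      ≤⟨ +-monoʳ-≤ (#heavy * c + #bad * c) ∑pendants≤ ⟩
    #heavy * c + #bad * c + numK R G ∎
    where
    open ≤-Reasoning
    c = t C r
    -- Every vertex is heavy, bad, or light with at least `c` pendant copies; each case is paid for
    -- by its own summand.
    pointwise : ∀ v → c ≤ 𝟙 (heavy? v) * c + 𝟙 (bad? v) * c + 𝟙 (light? v) * pendants v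
    pointwise v with heavy? v | pendants v ℕ.<? c
    ... | yes hv | _       = ≤-trans (≤-𝟙* (heavy? v) hv c) (≤-trans (m≤m+n _ (𝟙 (bad? v) * c)) (m≤m+n _ _))
    ... | no lv  | yes few = ≤-trans (≤-𝟙* (bad? v) (lv , few) c) (≤-trans (m≤n+m _ (𝟙 (heavy? v) * c)) (m≤m+n _ _))
    ... | no lv  | no ¬few = ≤-trans (≮⇒≥ ¬few) (≤-trans (≤-𝟙* (light? v) lv (pendants v)) (m≤n+m _ _))

-- Passage to the asymptotic statement

1≤nCk : ∀ {n k} → k ≤ n → 1 ≤ n C k
1≤nCk {n}     {zero}  _         = ≤-refl
1≤nCk {suc n} {suc k} (s≤s k≤n) =
  ≤-trans (1≤nCk k≤n) (≤-trans (m≤m+n _ _) (≤-reflexive (nCk+nC[k+1]≡[n+1]C[k+1] n k)))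

-- With K = k + 1, the threshold D = 2Kc·(Rc) makes the heavy vertices cost at most n / 2,
-- and N makes the boundedly many bad ones cost at most n / 2 as well.
module Asymptotics (r t k : ℕ) (1≤r : 1 ≤ r) (r≤t : r ≤ t) where

  K R c D M N : ℕ
  K = suc k
  R = suc r
  c = t C r
  D = 2 * K * c * (R * c)
  M = 1 + D * (D * R * R) + D * R
  -- The summand `t` makes room for the apex graph, `K * (t C R)` absorbs the lower-order term of
  -- `numK-apex≤`, and the last summand is for the bad vertices.
  N = t + K * (t C R) + 2 * K * c * (R * M)

  instance
    Rc≢0 : NonZero (R * c)
    Rc≢0 = >-nonZero (*-mono-≤ {1} {R} {1} {c} (s≤s z≤n) (1≤nCk r≤t))

  t≤N : t ≤ N
  t≤N = ≤-trans (m≤m+n t (K * (t C R))) (m≤m+n _ _)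

  upper : ∀ n → N ≤ n → K * numK R (apexGraph n t) ≤ K * (n * c) + n
  upper n N≤n = begin
    K * numK R (apexGraph n t)   ≤⟨ *-monoʳ-≤ K (numK-apex≤ n t r) ⟩
    K * (n * c + t C R)          ≡⟨ *-distribˡ-+ K (n * c) (t C R) ⟩
    K * (n * c) + K * (t C R)    ≤⟨ +-monoʳ-≤ (K * (n * c)) (≤-trans (m≤n+m _ t) (≤-trans (m≤m+n _ _) N≤n)) ⟩
    K * (n * c) + n              ∎
    where open ≤-Reasoning

  lower : ∀ n → N ≤ n → (G : Graph n) → StronglySat (suc (suc t)) G → K * (n * c) ≤ K * numK R G + n
  -- Only graphs with at most `n * c` copies need the structural argument, and for them the number
  -- of heavy vertices is controlled.
  lower n N≤n G sat with ≤-total (n * c) (numK R G)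
  ... | inj₁ nc≤T = ≤-trans (*-monoʳ-≤ K nc≤T) (m≤m+n _ n)
  ... | inj₂ T≤nc = begin
    K * (n * c)                                      ≤⟨ *-monoʳ-≤ K nC≤ ⟩
    K * (#heavy * c + #bad * c + numK R G)           ≡⟨ *-distribˡ-+ K (#heavy * c + #bad * c) (numK R G) ⟩
    K * (#heavy * c + #bad * c) + K * numK R G       ≤⟨ +-monoˡ-≤ (K * numK R G) exceptional ⟩
    n + K * numK R G                                 ≡⟨ +-comm n (K * numK R G) ⟩
    K * numK R G + n                                 ∎
    where
    open ≤-Reasoning
    open LowerBound r t 1≤r r≤t G sat D using (#heavy; #bad; #heavy*D≤; #bad≤; nC≤)

    heavy-cost : #heavy * (2 * K * c) ≤ n
    -- The factor `R * c` was put into `D` to be cancelled here.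
    heavy-cost = *-cancelʳ-≤ (#heavy * (2 * K * c)) n (R * c) (begin
      #heavy * (2 * K * c) * (R * c)   ≡⟨ *-assoc #heavy (2 * K * c) (R * c) ⟩
      #heavy * D                       ≤⟨ #heavy*D≤ ⟩
      numK R G * R                     ≤⟨ *-monoˡ-≤ R T≤nc ⟩
      n * c * R                        ≡⟨ trans (*-assoc n c R) (cong (n *_) (*-comm c R)) ⟩
      n * (R * c)                      ∎)

    bad-cost : 2 * K * c * #bad ≤ n
    bad-cost = ≤-trans (*-monoʳ-≤ (2 * K * c) #bad≤) (≤-trans (m≤n+m _ (t + K * (t C R))) N≤n)

    regroup : ∀ x y z w → 2 * (x * (y * z + w * z)) ≡ y * (2 * x * z) + 2 * x * z * w
    regroup = solve-∀

    exceptional : K * (#heavy * c + #bad * c) ≤ n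
    exceptional = *-cancelˡ-≤ 2 (begin
      2 * (K * (#heavy * c + #bad * c))              ≡⟨ regroup K #heavy c #bad ⟩
      #heavy * (2 * K * c) + 2 * K * c * #bad        ≤⟨ +-mono-≤ heavy-cost bad-cost ⟩
      n + n                                          ≡⟨ cong (n +_) (+-identityʳ n) ⟨
      2 * n                                          ∎)

-- The error term is expressed by a tolerance `1 / (k + 1)` with denominators cleared: for every `k`
-- and all large `n`, the minimum differs from the main term by at most `n / (k + 1)`.
theorem1p4 : (r s : ℕ) → 2 ≤ r → r < s →
    (k : ℕ) → Σ ℕ λ N → (n : ℕ) → N ≤ n →
    Σ ℕ λ m → IsSsat n r s m ×
    (suc k * m ≤ suc k * (n * ((s ∸ 2) C (r ∸ 1))) + n) ×
    (suc k * (n * ((s ∸ 2) C (r ∸ 1))) ≤ suc k * m + n)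
theorem1p4 (suc r) (suc (suc t)) (s≤s 1≤r) (s≤s (s≤s r≤t)) k = N , λ n N≤n →
  -- The apex graph serves twice: it shows that the minimum exists, and it bounds it from above. The
  -- lower bound is applied to a graph `G` attaining the minimum.
  let apexSat : StronglySat (suc (suc t)) (apexGraph n t)
      apexSat = apex-saturated (≤-trans t≤N N≤n)
      m , (G , sat , numK≡m) , least = ssat-exists (suc r) (suc (suc t)) (apexGraph n t) apexSat
  in m , ((G , sat , numK≡m) , least)
     , ≤-trans (*-monoʳ-≤ (suc k) (least (apexGraph n t) apexSat)) (upper n N≤n)
     , subst (λ x → suc k * (n * (t C r)) ≤ suc k * x + n) numK≡m (lower n N≤n G sat)
  where open Asymptotics r t k 1≤r r≤t
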